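{- Let $a,b$ be non-zero real numbers and let $(J_n)_{n\ge 0}$ be the bi-periodic Jacobsthal matrix sequence associated with $a,b$. Then its generating function (as a power series in $x$ with matrix coefficients) is $$\sum_{m=0}^{\infty}J_m x^m=\frac{J_0+J_1x+\left[aJ_1-(ab+2)J_0\right]x^2+\left[2bJ_0-2J_1\right]x^3}{1-(ab+4)x^2+4x^4},$$ which is expressed in component form as $$\sum_{m=0}^{\infty}J_m x^m=\frac{1}{1-(ab+4)x^2+4x^4}\begin{pmatrix} 1+bx-2x^2 & 2\frac{b}{a}x+2bx^2-4\frac{b}{a}x^3\\[2pt] x+ax^2-2x^3 & 1-(ab+2)x^2+2bx^3\end{pmatrix}.$$
   Context: Fix non-zero real numbers $a,b$. The bi-periodic Jacobsthal matrix sequence $(J_n)_{n\ge 0}$ of $2\times 2$ real matrices is defined by $J_0=\begin{pmatrix}1&0\\0&1\end{pmatrix}$, $J_1=\begin{pmatrix} b & 2\frac{b}{a}\\ 1&0\end{pmatrix}$, and for $n\ge 2$: $J_n=aJ_{n-1}+2J_{n-2}$ if $n$ is even, $J_n=bJ_{n-1}+2J_{n-2}$ if $n$ is odd. The identities are between formal power series in $x$ with coefficients in the $2\times2$ real matrices; division by the scalar polynomial $1-(ab+4)x^2+4x^4$ (constant term $1$) means multiplication by its inverse formal power series. -}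

module Defs where

open import Algebra.Bundles using (CommutativeRing)
import Algebra.Properties.Monoid.Sum as MonoidSum
open import Algebra.Structures
  using (IsMagma; IsSemigroup; IsMonoid; IsGroup; IsAbelianGroup; IsRing)
open import Data.Fin.Base using (zero; suc; toℕ)
open import Data.List.Base using (List; []; _∷_)
open import Data.Nat.Base as ℕ using (ℕ; zero; suc; _∸_)
import Data.Nat.Properties as ℕ
open import Data.Parity.Base using (0ℙ; 1ℙ)
open import Data.Product.Base using (∃-syntax; _×_; _,_)
open import Data.Rational.Base as ℚ using (ℚ; 0ℚ; 1ℚ; ½; ∣_∣; Positive)
import Data.Rational.Properties as ℚ
open import Data.Rational.Solver using (module +-*-Solver)
import Data.Vec.Functional as V
open import Data.Vec.Functional using (Vector)
open import Level using (Level; 0ℓ)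
open import Relation.Binary.PropositionalEquality
  using (_≡_; _≢_; refl; sym; trans; cong; cong₂; subst)
open import Relation.Binary.Structures using (IsEquivalence)
open import Relation.Nullary.Decidable using (yes; no)
open import Relation.Nullary.Negation using (contradiction)

-- Real numbers are Cauchy sequences of rationals. In x ~ y the two indices
-- vary independently, so that x ~ x says that x is a Cauchy sequence;
-- between Cauchy sequences, x ~ y says that x - y tends to zero.

infix 4 _~_

_~_ : (x y : ℕ → ℚ) → Set
x ~ y = ∀ ε → .{{Positive ε}} →
  ∃[ N ] (∀ m n → N ℕ.≤ m → N ℕ.≤ n → ∣ x m ℚ.- y n ∣ ℚ.< ε)

record ℝ : Set where
  no-eta-equality
  constructor mkℝ
  field
    term   : ℕ → ℚ
    cauchy : term ~ term

open ℝ public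

infix 4 _≈_

record _≈_ (x y : ℝ) : Set where
  no-eta-equality
  constructor mk≈
  field
    close : term x ~ term y

open _≈_ public

-- Being bounded away from zero is the constructive form of x ≉ 0 (the two
-- are classically equivalent), and is what makes x invertible.

record NonZero (x : ℝ) : Set where
  no-eta-equality
  field
    bound         : ℚ
    boundPositive : Positive bound
    stage         : ℕ
    bounded       : ∀ n → stage ℕ.≤ n → bound ℚ.≤ ∣ term x n ∣

private
  halve : ℚ → ℚ
  halve ε = ½ ℚ.* ε

  halve-positive : ∀ ε → .{{Positive ε}} → Positive (halve ε)
  halve-positive ε = ℚ.pos*pos⇒pos ½ ε

  opaque
    two-halves : ∀ ε → halve ε ℚ.+ halve ε ≡ ε
    two-halves ε = trans (sym (ℚ.*-distribʳ-+ ε ½ ½)) (ℚ.*-identityˡ ε)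

    small-+ : ∀ {ε} p q → ∣ p ∣ ℚ.< halve ε → ∣ q ∣ ℚ.< halve ε → ∣ p ℚ.+ q ∣ ℚ.< ε
    small-+ {ε} p q p< q< = begin-strict
      ∣ p ℚ.+ q ∣             ≤⟨ ℚ.∣p+q∣≤∣p∣+∣q∣ p q ⟩
      ∣ p ∣ ℚ.+ ∣ q ∣         <⟨ ℚ.+-mono-< p< q< ⟩
      halve ε ℚ.+ halve ε     ≡⟨ two-halves ε ⟩
      ε                       ∎
      where open ℚ.≤-Reasoning

    shrink : ∀ B → .{{Positive B}} → ∀ ε → .{{Positive ε}} →
      ∃[ δ ] Positive δ × (∀ p q → ∣ p ∣ ℚ.≤ B → ∣ q ∣ ℚ.< δ → ∣ p ℚ.* q ∣ ℚ.< ε)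
    shrink B ε = B⁻¹ ℚ.* ε , ℚ.pos*pos⇒pos B⁻¹ {{ℚ.1/pos⇒pos B}} ε ,
      λ p q p≤ q< → begin-strict
        ∣ p ℚ.* q ∣             ≡⟨ ℚ.∣p*q∣≡∣p∣*∣q∣ p q ⟩
        ∣ p ∣ ℚ.* ∣ q ∣         ≤⟨ ℚ.*-monoʳ-≤-nonNeg ∣ q ∣ {{ℚ.∣-∣-nonNeg q}} p≤ ⟩
        B ℚ.* ∣ q ∣             <⟨ ℚ.*-monoʳ-<-pos B q< ⟩
        B ℚ.* (B⁻¹ ℚ.* ε)       ≡⟨ ℚ.*-assoc B B⁻¹ ε ⟨
        (B ℚ.* B⁻¹) ℚ.* ε       ≡⟨ cong (ℚ._* ε) (ℚ.*-inverseʳ B) ⟩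
        1ℚ ℚ.* ε                ≡⟨ ℚ.*-identityˡ ε ⟩
        ε                       ∎
      where
      open ℚ.≤-Reasoning
      instance
        B≢0 : ℚ.NonZero B
        B≢0 = ℚ.pos⇒nonZero B
      B⁻¹ : ℚ
      B⁻¹ = ℚ.1/ B

    ∣p-q∣≡∣q-p∣ : ∀ p q → ∣ p ℚ.- q ∣ ≡ ∣ q ℚ.- p ∣
    ∣p-q∣≡∣q-p∣ p q = trans (cong ∣_∣ (solve 2 (λ p q → p :- q := :- (q :- p)) refl p q))
                            (ℚ.∣-p∣≡∣p∣ (q ℚ.- p))
      where open +-*-Solver

    ~-sym : ∀ x y → x ~ y → y ~ x
    ~-sym x y x~y ε with N , close ← x~y ε =
      N , λ m n N≤m N≤n → subst (ℚ._< ε) (∣p-q∣≡∣q-p∣ (x n) (y m)) (close n m N≤n N≤m)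

    ~-trans : ∀ x y z → x ~ y → y ~ z → x ~ z
    ~-trans x y z x~y y~z ε
      with M , close₁ ← x~y (halve ε) {{halve-positive ε}}
      with N , close₂ ← y~z (halve ε) {{halve-positive ε}} =
      M ℕ.⊔ N , λ m n ≤m ≤n →
        let k = M ℕ.⊔ N in
        subst (λ d → ∣ d ∣ ℚ.< ε)
          (solve 3 (λ p q r → (p :- q) :+ (q :- r) := p :- r) refl (x m) (y k) (z n))
          (small-+ (x m ℚ.- y k) (y k ℚ.- z n)
            (close₁ m k (ℕ.m⊔n≤o⇒m≤o M N ≤m) (ℕ.m≤m⊔n M N))
            (close₂ k n (ℕ.m≤n⊔m M N) (ℕ.m⊔n≤o⇒n≤o M N ≤n)))
      where open +-*-Solver

    eventually-≡⇒~ : ∀ x y → x ~ x → ∀ M → (∀ n → M ℕ.≤ n → x n ≡ y n) → x ~ y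
    eventually-≡⇒~ x y x~x M x≡y ε with N , close ← x~x ε =
      M ℕ.⊔ N , λ m n ≤m ≤n →
        subst (λ q → ∣ x m ℚ.- q ∣ ℚ.< ε) (x≡y n (ℕ.m⊔n≤o⇒m≤o M N ≤n))
          (close m n (ℕ.m⊔n≤o⇒n≤o M N ≤m) (ℕ.m⊔n≤o⇒n≤o M N ≤n))

    constant-~ : ∀ p → (λ _ → p) ~ (λ _ → p)
    constant-~ p ε =
      0 , λ _ _ _ _ → subst (λ d → ∣ d ∣ ℚ.< ε) (sym (ℚ.+-inverseʳ p)) (ℚ.positive⁻¹ ε)

    +-~ : ∀ x y u v → x ~ y → u ~ v → (λ n → x n ℚ.+ u n) ~ (λ n → y n ℚ.+ v n)
    +-~ x y u v x~y u~v ε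
      with M , close₁ ← x~y (halve ε) {{halve-positive ε}}
      with N , close₂ ← u~v (halve ε) {{halve-positive ε}} =
      M ℕ.⊔ N , λ m n ≤m ≤n →
        subst (λ d → ∣ d ∣ ℚ.< ε)
          (solve 4 (λ p q r s → (p :- q) :+ (r :- s) := (p :+ r) :- (q :+ s)) refl
            (x m) (y n) (u m) (v n))
          (small-+ (x m ℚ.- y n) (u m ℚ.- v n)
            (close₁ m n (ℕ.m⊔n≤o⇒m≤o M N ≤m) (ℕ.m⊔n≤o⇒m≤o M N ≤n))
            (close₂ m n (ℕ.m⊔n≤o⇒n≤o M N ≤m) (ℕ.m⊔n≤o⇒n≤o M N ≤n)))
      where open +-*-Solver

    neg-~ : ∀ x y → x ~ y → (λ n → ℚ.- x n) ~ (λ n → ℚ.- y n)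
    neg-~ x y x~y ε with N , close ← x~y ε =
      N , λ m n ≤m ≤n → subst (ℚ._< ε)
        (trans (∣p-q∣≡∣q-p∣ (x m) (y n))
          (cong ∣_∣ (solve 2 (λ p q → q :- p := (:- p) :- (:- q)) refl (x m) (y n))))
        (close m n ≤m ≤n)
      where open +-*-Solver

    ~⇒boundedˡ : ∀ x y → x ~ y →
      ∃[ B ] Positive B × ∃[ N ] (∀ n → N ℕ.≤ n → ∣ x n ∣ ℚ.≤ B)
    ~⇒boundedˡ x y x~y with N , close ← x~y 1ℚ =
      1ℚ ℚ.+ ∣ y N ∣ ,
      ℚ.pos+nonNeg⇒pos 1ℚ ∣ y N ∣ {{ℚ.∣-∣-nonNeg (y N)}} ,
      N , λ n ≤n → begin
        ∣ x n ∣                          ≡⟨ cong ∣_∣ (solve 2 (λ p q → p := (p :- q) :+ q) refl (x n) (y N)) ⟩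
        ∣ (x n ℚ.- y N) ℚ.+ y N ∣        ≤⟨ ℚ.∣p+q∣≤∣p∣+∣q∣ (x n ℚ.- y N) (y N) ⟩
        ∣ x n ℚ.- y N ∣ ℚ.+ ∣ y N ∣      ≤⟨ ℚ.+-monoˡ-≤ ∣ y N ∣ (ℚ.<⇒≤ (close n N ≤n ℕ.≤-refl)) ⟩
        1ℚ ℚ.+ ∣ y N ∣                   ∎
      where
      open ℚ.≤-Reasoning
      open +-*-Solver using (solve; _:=_; _:+_; _:-_)

    *-difference : ∀ p q r s → p ℚ.* (r ℚ.- s) ℚ.+ s ℚ.* (p ℚ.- q) ≡ p ℚ.* r ℚ.- q ℚ.* s
    *-difference = solve 4 (λ p q r s → p :* (r :- s) :+ s :* (p :- q) := p :* r :- q :* s) refl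
      where open +-*-Solver

    *-~ : ∀ x y u v → x ~ y → u ~ v → (λ n → x n ℚ.* u n) ~ (λ n → y n ℚ.* v n)
    *-~ x y u v x~y u~v ε =
      let (B , B>0 , K , x≤B)    = ~⇒boundedˡ x y x~y
          (C , C>0 , L , v≤C)    = ~⇒boundedˡ v u (~-sym u v u~v)
          (δ , δ>0 , small₁)     = shrink B {{B>0}} (halve ε) {{halve-positive ε}}
          (η , η>0 , small₂)     = shrink C {{C>0}} (halve ε) {{halve-positive ε}}
          (M , close₁)           = u~v δ {{δ>0}}
          (N , close₂)           = x~y η {{η>0}}
      in
      (K ℕ.⊔ L) ℕ.⊔ (M ℕ.⊔ N) , λ m n ≤m ≤n →
        let KL≤m = ℕ.m⊔n≤o⇒m≤o (K ℕ.⊔ L) (M ℕ.⊔ N) ≤m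
            KL≤n = ℕ.m⊔n≤o⇒m≤o (K ℕ.⊔ L) (M ℕ.⊔ N) ≤n
            MN≤m = ℕ.m⊔n≤o⇒n≤o (K ℕ.⊔ L) (M ℕ.⊔ N) ≤m
            MN≤n = ℕ.m⊔n≤o⇒n≤o (K ℕ.⊔ L) (M ℕ.⊔ N) ≤n
        in
        subst (λ d → ∣ d ∣ ℚ.< ε) (*-difference (x m) (y n) (u m) (v n))
          (small-+ (x m ℚ.* (u m ℚ.- v n)) (v n ℚ.* (x m ℚ.- y n))
            (small₁ (x m) (u m ℚ.- v n)
              (x≤B m (ℕ.m⊔n≤o⇒m≤o K L KL≤m))
              (close₁ m n (ℕ.m⊔n≤o⇒m≤o M N MN≤m) (ℕ.m⊔n≤o⇒m≤o M N MN≤n)))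
            (small₂ (v n) (x m ℚ.- y n)
              (v≤C n (ℕ.m⊔n≤o⇒n≤o K L KL≤n))
              (close₂ m n (ℕ.m⊔n≤o⇒n≤o M N MN≤m) (ℕ.m⊔n≤o⇒n≤o M N MN≤n))))

fromℚ : ℚ → ℝ
fromℚ p = mkℝ (λ _ → p) (constant-~ p)

private
  _+ℝ_ _*ℝ_ : ℝ → ℝ → ℝ
  x +ℝ y = mkℝ (λ n → term x n ℚ.+ term y n) (+-~ (term x) (term x) (term y) (term y) (cauchy x) (cauchy y))
  x *ℝ y = mkℝ (λ n → term x n ℚ.* term y n) (*-~ (term x) (term x) (term y) (term y) (cauchy x) (cauchy y))

  -ℝ_ : ℝ → ℝ
  -ℝ x = mkℝ (λ n → ℚ.- term x n) (neg-~ (term x) (term x) (cauchy x))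

  termwise : ∀ {x y} → (∀ n → term x n ≡ term y n) → x ≈ y
  termwise {x} {y} x≡y = mk≈ (eventually-≡⇒~ (term x) (term y) (cauchy x) 0 (λ n _ → x≡y n))

  ≈-sym : ∀ {x y} → x ≈ y → y ≈ x
  ≈-sym {x} {y} x≈y = mk≈ (~-sym (term x) (term y) (close x≈y))

  ≈-trans : ∀ {x y z} → x ≈ y → y ≈ z → x ≈ z
  ≈-trans {x} {y} {z} x≈y y≈z =
    mk≈ (~-trans (term x) (term y) (term z) (close x≈y) (close y≈z))

  neg-cong : ∀ {x y} → x ≈ y → (-ℝ x) ≈ (-ℝ y)
  neg-cong {x} {y} x≈y = mk≈ (neg-~ (term x) (term y) (close x≈y))

  +-cong : ∀ {x y u v} → x ≈ y → u ≈ v → (x +ℝ u) ≈ (y +ℝ v)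
  +-cong {x} {y} {u} {v} x≈y u≈v =
    mk≈ (+-~ (term x) (term y) (term u) (term v) (close x≈y) (close u≈v))

  *-cong : ∀ {x y u v} → x ≈ y → u ≈ v → (x *ℝ u) ≈ (y *ℝ v)
  *-cong {x} {y} {u} {v} x≈y u≈v =
    mk≈ (*-~ (term x) (term y) (term u) (term v) (close x≈y) (close u≈v))

  +-assoc : ∀ x y z → ((x +ℝ y) +ℝ z) ≈ (x +ℝ (y +ℝ z))
  +-assoc x y z = termwise λ n → ℚ.+-assoc (term x n) (term y n) (term z n)

  +-identityˡ : ∀ x → (fromℚ 0ℚ +ℝ x) ≈ x
  +-identityˡ x = termwise λ n → ℚ.+-identityˡ (term x n)

  +-identityʳ : ∀ x → (x +ℝ fromℚ 0ℚ) ≈ x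
  +-identityʳ x = termwise λ n → ℚ.+-identityʳ (term x n)

  +-inverseˡ : ∀ x → ((-ℝ x) +ℝ x) ≈ fromℚ 0ℚ
  +-inverseˡ x = termwise λ n → ℚ.+-inverseˡ (term x n)

  +-inverseʳ : ∀ x → (x +ℝ (-ℝ x)) ≈ fromℚ 0ℚ
  +-inverseʳ x = termwise λ n → ℚ.+-inverseʳ (term x n)

  +-comm : ∀ x y → (x +ℝ y) ≈ (y +ℝ x)
  +-comm x y = termwise λ n → ℚ.+-comm (term x n) (term y n)

  *-assoc : ∀ x y z → ((x *ℝ y) *ℝ z) ≈ (x *ℝ (y *ℝ z))
  *-assoc x y z = termwise λ n → ℚ.*-assoc (term x n) (term y n) (term z n)

  *-identityˡ : ∀ x → (fromℚ 1ℚ *ℝ x) ≈ x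
  *-identityˡ x = termwise λ n → ℚ.*-identityˡ (term x n)

  *-identityʳ : ∀ x → (x *ℝ fromℚ 1ℚ) ≈ x
  *-identityʳ x = termwise λ n → ℚ.*-identityʳ (term x n)

  *-distribˡ-+ : ∀ x y z → (x *ℝ (y +ℝ z)) ≈ ((x *ℝ y) +ℝ (x *ℝ z))
  *-distribˡ-+ x y z = termwise λ n → ℚ.*-distribˡ-+ (term x n) (term y n) (term z n)

  *-distribʳ-+ : ∀ x y z → ((y +ℝ z) *ℝ x) ≈ ((y *ℝ x) +ℝ (z *ℝ x))
  *-distribʳ-+ x y z = termwise λ n → ℚ.*-distribʳ-+ (term x n) (term y n) (term z n)

  *-comm : ∀ x y → (x *ℝ y) ≈ (y *ℝ x)
  *-comm x y = termwise λ n → ℚ.*-comm (term x n) (term y n)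

  ≈-isEquivalence : IsEquivalence _≈_
  ≈-isEquivalence = record
    { refl = λ {x} → mk≈ (cauchy x) ; sym = ≈-sym ; trans = ≈-trans }

  +-isMagma : IsMagma _≈_ _+ℝ_
  +-isMagma = record { isEquivalence = ≈-isEquivalence ; ∙-cong = +-cong }

  +-isSemigroup : IsSemigroup _≈_ _+ℝ_
  +-isSemigroup = record { isMagma = +-isMagma ; assoc = +-assoc }

  +-isMonoid : IsMonoid _≈_ _+ℝ_ (fromℚ 0ℚ)
  +-isMonoid = record
    { isSemigroup = +-isSemigroup ; identity = +-identityˡ , +-identityʳ }

  +-isGroup : IsGroup _≈_ _+ℝ_ (fromℚ 0ℚ) -ℝ_
  +-isGroup = record
    { isMonoid = +-isMonoid ; inverse = +-inverseˡ , +-inverseʳ ; ⁻¹-cong = neg-cong }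

  +-isAbelianGroup : IsAbelianGroup _≈_ _+ℝ_ (fromℚ 0ℚ) -ℝ_
  +-isAbelianGroup = record { isGroup = +-isGroup ; comm = +-comm }

  +-*-isRing : IsRing _≈_ _+ℝ_ _*ℝ_ -ℝ_ (fromℚ 0ℚ) (fromℚ 1ℚ)
  +-*-isRing = record
    { +-isAbelianGroup = +-isAbelianGroup
    ; *-cong           = *-cong
    ; *-assoc          = *-assoc
    ; *-identity       = *-identityˡ , *-identityʳ
    ; distrib          = *-distribˡ-+ , *-distribʳ-+
    }

ℝ-commutativeRing : CommutativeRing 0ℓ 0ℓ
ℝ-commutativeRing = record
  { isCommutativeRing = record { isRing = +-*-isRing ; *-comm = *-comm } }

open CommutativeRing ℝ-commutativeRing public
  using (_+_; _*_; _-_; -_; 0#; 1#)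

2# 4# : ℝ
2# = 1# + 1#
4# = 2# + 2#

private
  reciprocalℚ : ℚ → ℚ
  reciprocalℚ p with p ℚ.≟ 0ℚ
  ... | yes _   = 0ℚ
  ... | no  p≢0 = (ℚ.1/ p) {{ℚ.≢-nonZero p≢0}}

  *-reciprocalℚ : ∀ p → p ≢ 0ℚ → p ℚ.* reciprocalℚ p ≡ 1ℚ
  *-reciprocalℚ p p≢0 with p ℚ.≟ 0ℚ
  ... | yes p≡0 = contradiction p≡0 p≢0
  ... | no  p≢0 = ℚ.*-inverseʳ p {{ℚ.≢-nonZero p≢0}}

  bounded⇒≢0 : ∀ δ → .{{Positive δ}} → ∀ p → δ ℚ.≤ ∣ p ∣ → p ≢ 0ℚ
  bounded⇒≢0 δ p δ≤∣p∣ refl = ℚ.<-irrefl refl (ℚ.<-≤-trans (ℚ.positive⁻¹ δ) δ≤∣p∣)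

  reciprocalℚ-close : ∀ δ → .{{_ : Positive δ}} → ∀ {ε} p q →
    δ ℚ.≤ ∣ p ∣ → δ ℚ.≤ ∣ q ∣ → ∣ p ℚ.- q ∣ ℚ.< (δ ℚ.* δ) ℚ.* ε →
    ∣ reciprocalℚ p ℚ.- reciprocalℚ q ∣ ℚ.< ε
  reciprocalℚ-close δ {ε} p q δ≤p δ≤q p-q< =
    ℚ.*-cancelˡ-<-nonNeg (δ ℚ.* δ) {{ℚ.pos⇒nonNeg (δ ℚ.* δ) {{ℚ.pos*pos⇒pos δ δ}}}} (begin-strict
      (δ ℚ.* δ) ℚ.* ∣ d ∣                ≤⟨ ℚ.*-monoʳ-≤-nonNeg ∣ d ∣ {{ℚ.∣-∣-nonNeg d}} δδ≤pq ⟩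
      (∣ p ∣ ℚ.* ∣ q ∣) ℚ.* ∣ d ∣        ≡⟨ cong (ℚ._* ∣ d ∣) (ℚ.∣p*q∣≡∣p∣*∣q∣ p q) ⟨
      ∣ p ℚ.* q ∣ ℚ.* ∣ d ∣              ≡⟨ ℚ.∣p*q∣≡∣p∣*∣q∣ (p ℚ.* q) d ⟨
      ∣ (p ℚ.* q) ℚ.* d ∣                ≡⟨ cong ∣_∣ pqd≡q-p ⟩
      ∣ q ℚ.- p ∣                        ≡⟨ ∣p-q∣≡∣q-p∣ q p ⟩
      ∣ p ℚ.- q ∣                        <⟨ p-q< ⟩
      (δ ℚ.* δ) ℚ.* ε                    ∎)
    where
    open ℚ.≤-Reasoning
    open +-*-Solver using (solve; _:=_; _:*_; _:-_)
    p⁻¹ = reciprocalℚ p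
    q⁻¹ = reciprocalℚ q
    d   = p⁻¹ ℚ.- q⁻¹

    δδ≤pq : δ ℚ.* δ ℚ.≤ ∣ p ∣ ℚ.* ∣ q ∣
    δδ≤pq = ℚ.≤-trans (ℚ.*-monoʳ-≤-nonNeg δ {{ℚ.pos⇒nonNeg δ}} δ≤p)
                      (ℚ.*-monoˡ-≤-nonNeg ∣ p ∣ {{ℚ.∣-∣-nonNeg p}} δ≤q)

    pqd≡q-p : (p ℚ.* q) ℚ.* d ≡ q ℚ.- p
    pqd≡q-p = trans
      (solve 4 (λ p q r s → (p :* q) :* (r :- s) := q :* (p :* r) :- p :* (q :* s))
        refl p q p⁻¹ q⁻¹)
      (cong₂ ℚ._-_
        (trans (cong (q ℚ.*_) (*-reciprocalℚ p (bounded⇒≢0 δ p δ≤p))) (ℚ.*-identityʳ q))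
        (trans (cong (p ℚ.*_) (*-reciprocalℚ q (bounded⇒≢0 δ q δ≤q))) (ℚ.*-identityʳ p)))

  opaque
    reciprocal-~ : ∀ x → (x≠0 : NonZero x) →
      (λ n → reciprocalℚ (term x n)) ~ (λ n → reciprocalℚ (term x n))
    reciprocal-~ x x≠0 ε =
      let open NonZero x≠0
          instance δ>0 = boundPositive
          (N , close) = cauchy x ((bound ℚ.* bound) ℚ.* ε)
            {{ℚ.pos*pos⇒pos (bound ℚ.* bound) {{ℚ.pos*pos⇒pos bound bound}} ε}}
      in
      stage ℕ.⊔ N , λ m n ≤m ≤n →
        reciprocalℚ-close bound (term x m) (term x n)
          (bounded m (ℕ.m⊔n≤o⇒m≤o stage N ≤m))
          (bounded n (ℕ.m⊔n≤o⇒m≤o stage N ≤n))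
          (close m n (ℕ.m⊔n≤o⇒n≤o stage N ≤m) (ℕ.m⊔n≤o⇒n≤o stage N ≤n))

infix 8 _⁻¹

_⁻¹ : (x : ℝ) → {{NonZero x}} → ℝ
_⁻¹ x {{x≠0}} = mkℝ (λ n → reciprocalℚ (term x n)) (reciprocal-~ x x≠0)

⁻¹-inverseʳ : ∀ x → {{_ : NonZero x}} → x * x ⁻¹ ≈ 1#
⁻¹-inverseʳ x {{x≠0}} = mk≈ (eventually-≡⇒~ (term (x * x ⁻¹)) (term 1#) (cauchy (x * x ⁻¹)) stage
  λ n ≤n → *-reciprocalℚ (term x n)
    (bounded⇒≢0 bound {{boundPositive}} (term x n) (bounded n ≤n)))
  where open NonZero x≠0

infixl 7 _÷_

_÷_ : (x y : ℝ) → {{NonZero y}} → ℝ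
x ÷ y = x * y ⁻¹

private
  variable
    a : Level
    A : Set a

Matrix₂ : Set a → Set a
Matrix₂ A = Vector (Vector A 2) 2

-- ∑ₘ cₘ xᵐ is represented by its sequence of coefficients m ↦ cₘ.

Series : Set a → Set a
Series A = ℕ → A

-- polynomial 0 (c₀ ∷ c₁ ∷ … ∷ cₖ ∷ []) is c₀ + c₁ x + ⋯ + cₖ xᵏ.

polynomial : A → List A → Series A
polynomial 0A []       n       = 0A
polynomial 0A (c ∷ cs) zero    = c
polynomial 0A (c ∷ cs) (suc n) = polynomial 0A cs n

-- The identification of matrices of power series with power series of
-- matrices.

collect : Matrix₂ (Series A) → Series (Matrix₂ A)
collect P n i j = P i j n

module MatrixSeries {c ℓ} (R : CommutativeRing c ℓ) where

  private
    module R = CommutativeRing R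
    open R using (Carrier)

  open MonoidSum R.+-monoid using (sum; sum⁺-syntax; sum-cong-≋)

  infixl 6 _+ᴹ_ _-ᴹ_
  infixr 7 _·ᴹ_

  _+ᴹ_ _-ᴹ_ : Matrix₂ Carrier → Matrix₂ Carrier → Matrix₂ Carrier
  (X +ᴹ Y) i j = X i j R.+ Y i j
  (X -ᴹ Y) i j = X i j R.- Y i j

  _·ᴹ_ : Carrier → Matrix₂ Carrier → Matrix₂ Carrier
  (s ·ᴹ X) i j = s R.* X i j

  0ᴹ 1ᴹ : Matrix₂ Carrier
  0ᴹ _ _ = R.0#
  1ᴹ = (R.1# V.∷ R.0# V.∷ V.[]) V.∷
       (R.0# V.∷ R.1# V.∷ V.[]) V.∷ V.[]

  infix 4 _≈ᴹ_

  _≈ᴹ_ : (F G : Series (Matrix₂ Carrier)) → Set ℓ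
  F ≈ᴹ G = ∀ n i j → F n i j R.≈ G n i j

  infixl 7 _⊛_ _⊛ᴹ_ _/_

  _⊛_ : Series Carrier → Series Carrier → Series Carrier
  (p ⊛ q) n = ∑[ k ≤ n ] (p (toℕ k) R.* q (n ∸ toℕ k))

  _⊛ᴹ_ : Series Carrier → Series (Matrix₂ Carrier) → Series (Matrix₂ Carrier)
  (p ⊛ᴹ F) n i j = (p ⊛ (λ m → F m i j)) n

  -- The coefficients qₙ , … , q₀ of the inverse q of a power series p with
  -- constant term 1, from q₀ = 1 and qₙ₊₁ = - ∑ₖ pₖ₊₁ qₙ₋ₖ.

  inverseUpTo : Series Carrier → ∀ n → Vector Carrier (suc n)
  inverseUpTo p zero    = R.1# V.∷ V.[]
  inverseUpTo p (suc n) =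
    (R.- (∑[ k ≤ n ] (p (suc (toℕ k)) R.* inverseUpTo p n k))) V.∷ inverseUpTo p n

  inverse : Series Carrier → Series Carrier
  inverse p n = inverseUpTo p n zero

  one : Series Carrier
  one = polynomial R.0# (R.1# ∷ [])

  inverseUpTo-lookup : ∀ p n k → inverseUpTo p n k ≡ inverse p (n ∸ toℕ k)
  inverseUpTo-lookup p n       zero    = refl
  inverseUpTo-lookup p (suc n) (suc k) = inverseUpTo-lookup p n k

  inverse-inverseʳ : ∀ p → p 0 R.≈ R.1# → ∀ n → (p ⊛ inverse p) n R.≈ one n
  inverse-inverseʳ p p₀≈1 zero = begin
    p 0 R.* R.1# R.+ R.0#  ≈⟨ R.+-identityʳ _ ⟩
    p 0 R.* R.1#           ≈⟨ R.*-identityʳ _ ⟩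
    p 0                    ≈⟨ p₀≈1 ⟩
    R.1#                   ∎
    where open import Relation.Binary.Reasoning.Setoid R.setoid
  inverse-inverseʳ p p₀≈1 (suc n) = begin
    p 0 R.* R.- s R.+ sum {suc n} (λ k → p (suc (toℕ k)) R.* inverse p (n ∸ toℕ k))
      ≈⟨ R.+-cong (R.trans (R.*-congʳ p₀≈1) (R.*-identityˡ _))
                  (sum-cong-≋ {suc n} λ k → R.*-congˡ {p (suc (toℕ k))}
                    (R.reflexive (sym (inverseUpTo-lookup p n k)))) ⟩
    R.- s R.+ s
      ≈⟨ R.-‿inverseˡ s ⟩
    R.0# ∎
    where
    open import Relation.Binary.Reasoning.Setoid R.setoid
    s = ∑[ k ≤ n ] (p (suc (toℕ k)) R.* inverseUpTo p n k)

  -- Only meaningful when p has constant term 1 (see inverse-inverseʳ).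

  _/_ : Series (Matrix₂ Carrier) → Series Carrier → Series (Matrix₂ Carrier)
  F / p = inverse p ⊛ᴹ F

open MatrixSeries ℝ-commutativeRing public

multiplier : (a b : ℝ) → ℕ → ℝ
multiplier a b n with ℕ.parity n
... | 0ℙ = a
... | 1ℙ = b

jacobsthal : (a b : ℝ) → {{NonZero a}} → ℕ → Matrix₂ ℝ
jacobsthal a b zero          = 1ᴹ
jacobsthal a b (suc zero)    = (b  V.∷ 2# * (b ÷ a) V.∷ V.[]) V.∷
                               (1# V.∷ 0#           V.∷ V.[]) V.∷ V.[]
jacobsthal a b (suc (suc n)) =
  multiplier a b (suc (suc n)) ·ᴹ jacobsthal a b (suc n) +ᴹ 2# ·ᴹ jacobsthal a b n

{-# OPTIONS --safe #-}

-- Eliminating the odd-indexed (respectively even-indexed) matrices from three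
-- consecutive instances of the recurrence gives
-- Jₙ₊₄ = (ab + 4) Jₙ₊₂ - 4 Jₙ for every n, whatever its parity. Hence the
-- denominator D annihilates J from degree 4 on, and the numerator is D J.

module Submission where

open import Defs
open import Algebra.Bundles using (CommutativeRing)
import Algebra.Properties.CommutativeSemigroup as CommutativeSemigroupProperties
open import Algebra.Solver.Ring.AlmostCommutativeRing
  using (fromCommutativeRing; _-Raw-AlmostCommutative⟶_)
import Algebra.Solver.Ring as RingSolver
open import Data.Fin.Base using (zero; suc)
open import Data.List.Base using ([]; _∷_)
open import Data.Maybe.Base using (Maybe; just; nothing)
open import Data.Nat.Base using (zero; suc)
open import Data.Product.Base using (_×_; _,_)
open import Data.Rational.Base as ℚ using (ℚ; 0ℚ; 1ℚ)
import Data.Rational.Properties as ℚ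
import Data.Vec.Functional as V
open import Function.Base using (_∘_)
import Relation.Binary.Reasoning.Setoid as ≈-Reasoning
open import Relation.Binary.PropositionalEquality using (refl)
open import Relation.Nullary.Decidable using (yes; no)

-- Algebra of the Cauchy product of power series.

module CauchyProduct {c ℓ} (R : CommutativeRing c ℓ) where

  private
    module S = MatrixSeries R
    variable
      p q : Series (CommutativeRing.Carrier R)
  open CommutativeRing R
    using (setoid; +-cong; +-congˡ; +-congʳ; *-cong; *-congˡ; *-congʳ;
           +-identityʳ; *-identityˡ; zeroˡ; distribˡ; distribʳ; *-assoc; *-comm)
    renaming (_≈_ to _≈ᴿ_; _+_ to _⊕_; _*_ to _⊙_; 0# to 0ᴿ; 1# to 1ᴿ;
              refl to reflᴿ; sym to symᴿ; trans to transᴿ; +-assoc to ⊕-assoc;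
              +-commutativeSemigroup to ⊕-commutativeSemigroup)
  open MatrixSeries R using () renaming (_⊛_ to _⋆_)
  open CommutativeSemigroupProperties ⊕-commutativeSemigroup using (x∙yz≈y∙xz; interchange)
  open ≈-Reasoning setoid

  -- By definitional unfolding, `(p ⋆ r) (suc n)` is `p 0 ⊙ r (suc n) ⊕ ((p ∘ suc) ⋆ r) n`. The
  -- inductions on the degree below peel off this first summand and pass to the tail of the left
  -- factor.
  ⋆-cong : (∀ n → p n ≈ᴿ q n) → ∀ {r s} → (∀ n → r n ≈ᴿ s n) →
    ∀ n → (p ⋆ r) n ≈ᴿ (q ⋆ s) n
  ⋆-cong p≈q r≈s zero    = +-congʳ (*-cong (p≈q 0) (r≈s 0))
  ⋆-cong p≈q r≈s (suc n) =
    +-cong (*-cong (p≈q 0) (r≈s (suc n))) (⋆-cong (p≈q ∘ suc) r≈s n)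

  ⋆-zeroˡ : (∀ n → p n ≈ᴿ 0ᴿ) → ∀ q n → (p ⋆ q) n ≈ᴿ 0ᴿ
  ⋆-zeroˡ p≈0 q zero    = transᴿ (+-identityʳ _) (transᴿ (*-congʳ (p≈0 0)) (zeroˡ _))
  ⋆-zeroˡ p≈0 q (suc n) = begin
    _  ≈⟨ +-cong (transᴿ (*-congʳ (p≈0 0)) (zeroˡ _)) (⋆-zeroˡ (p≈0 ∘ suc) q n) ⟩
    0ᴿ ⊕ 0ᴿ  ≈⟨ +-identityʳ _ ⟩
    0ᴿ  ∎

  -- Serves twice: for the unit series, and for the last coefficient of the denominator, left alone
  -- once the earlier ones are split off.
  constant-⋆ : ∀ s q n → (polynomial 0ᴿ (s ∷ []) ⋆ q) n ≈ᴿ s ⊙ q n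
  constant-⋆ s q zero    = +-identityʳ _
  constant-⋆ s q (suc n) =
    transᴿ (+-congˡ (⋆-zeroˡ (λ _ → reflᴿ) q n)) (+-identityʳ _)

  ⋆-identityˡ : ∀ q n → (S.one ⋆ q) n ≈ᴿ q n
  ⋆-identityˡ q n = transᴿ (constant-⋆ 1ᴿ q n) (*-identityˡ _)

  -- Mirror image of the definitional unfolding: the last summand is split off instead of the first.
  -- Commutativity follows by matching the two.
  ⋆-tailʳ : ∀ p q n → (p ⋆ q) (suc n) ≈ᴿ p (suc n) ⊙ q 0 ⊕ (p ⋆ (q ∘ suc)) n
  ⋆-tailʳ p q zero    = x∙yz≈y∙xz _ _ _
  ⋆-tailʳ p q (suc n) =
    transᴿ (+-congˡ (⋆-tailʳ (p ∘ suc) q n)) (x∙yz≈y∙xz _ _ _)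

  ⋆-comm : ∀ p q n → (p ⋆ q) n ≈ᴿ (q ⋆ p) n
  ⋆-comm p q zero    = +-congʳ (*-comm _ _)
  ⋆-comm p q (suc n) = begin
    p 0 ⊙ q (suc n) ⊕ ((p ∘ suc) ⋆ q) n  ≈⟨ +-cong (*-comm _ _) (⋆-comm (p ∘ suc) q n) ⟩
    q (suc n) ⊙ p 0 ⊕ (q ⋆ (p ∘ suc)) n  ≈⟨ ⋆-tailʳ q p n ⟨
    (q ⋆ p) (suc n)                      ∎

  -- The left factor has the shape that the tail of a product takes, `p 0` times the tail of `q`
  -- plus `(p ∘ suc) ⋆ q`; this is what associativity needs.
  ⋆-linearˡ : ∀ s p q r n →
    ((λ m → s ⊙ p m ⊕ q m) ⋆ r) n ≈ᴿ s ⊙ (p ⋆ r) n ⊕ (q ⋆ r) n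
  ⋆-linearˡ s p q r zero    = begin
    (s ⊙ p 0 ⊕ q 0) ⊙ r 0 ⊕ 0ᴿ          ≈⟨ +-identityʳ _ ⟩
    (s ⊙ p 0 ⊕ q 0) ⊙ r 0               ≈⟨ distribʳ _ _ _ ⟩
    (s ⊙ p 0) ⊙ r 0 ⊕ q 0 ⊙ r 0         ≈⟨ +-congʳ (*-assoc _ _ _) ⟩
    s ⊙ (p 0 ⊙ r 0) ⊕ q 0 ⊙ r 0         ≈⟨ +-cong (*-congˡ (+-identityʳ _)) (+-identityʳ _) ⟨
    s ⊙ (p ⋆ r) 0 ⊕ (q ⋆ r) 0           ∎
  ⋆-linearˡ s p q r (suc n) = begin
    (s ⊙ p 0 ⊕ q 0) ⊙ r (suc n) ⊕ ((λ m → s ⊙ p (suc m) ⊕ q (suc m)) ⋆ r) n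
      ≈⟨ +-cong (distribʳ _ _ _) (⋆-linearˡ s (p ∘ suc) (q ∘ suc) r n) ⟩
    ((s ⊙ p 0) ⊙ r (suc n) ⊕ q 0 ⊙ r (suc n)) ⊕ (s ⊙ ((p ∘ suc) ⋆ r) n ⊕ ((q ∘ suc) ⋆ r) n)
      ≈⟨ interchange _ _ _ _ ⟩
    ((s ⊙ p 0) ⊙ r (suc n) ⊕ s ⊙ ((p ∘ suc) ⋆ r) n) ⊕ (q ⋆ r) (suc n)
      ≈⟨ +-congʳ (transᴿ (+-congʳ (*-assoc _ _ _)) (symᴿ (distribˡ _ _ _))) ⟩
    s ⊙ (p ⋆ r) (suc n) ⊕ (q ⋆ r) (suc n) ∎

  ⋆-assoc : ∀ p q r n → ((p ⋆ q) ⋆ r) n ≈ᴿ (p ⋆ (q ⋆ r)) n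
  ⋆-assoc p q r zero    = +-congʳ (begin
    (p 0 ⊙ q 0 ⊕ 0ᴿ) ⊙ r 0   ≈⟨ *-congʳ (+-identityʳ _) ⟩
    (p 0 ⊙ q 0) ⊙ r 0        ≈⟨ *-assoc _ _ _ ⟩
    p 0 ⊙ (q 0 ⊙ r 0)        ≈⟨ *-congˡ (+-identityʳ _) ⟨
    p 0 ⊙ (q 0 ⊙ r 0 ⊕ 0ᴿ)   ∎)
  ⋆-assoc p q r (suc n) = begin
    (p ⋆ q) 0 ⊙ r (suc n) ⊕ ((λ m → p 0 ⊙ q (suc m) ⊕ ((p ∘ suc) ⋆ q) m) ⋆ r) n
      ≈⟨ +-cong (transᴿ (*-congʳ (+-identityʳ _)) (*-assoc _ _ _))
                (⋆-linearˡ (p 0) (q ∘ suc) ((p ∘ suc) ⋆ q) r n) ⟩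
    p 0 ⊙ (q 0 ⊙ r (suc n)) ⊕ (p 0 ⊙ ((q ∘ suc) ⋆ r) n ⊕ (((p ∘ suc) ⋆ q) ⋆ r) n)
      ≈⟨ ⊕-assoc _ _ _ ⟨
    (p 0 ⊙ (q 0 ⊙ r (suc n)) ⊕ p 0 ⊙ ((q ∘ suc) ⋆ r) n) ⊕ (((p ∘ suc) ⋆ q) ⋆ r) n
      ≈⟨ +-cong (symᴿ (distribˡ _ _ _)) (⋆-assoc (p ∘ suc) q r n) ⟩
    p 0 ⊙ (q ⋆ r) (suc n) ⊕ ((p ∘ suc) ⋆ (q ⋆ r)) n ∎

  -- Multiply by the inverse from the left and reassociate. Only a right inverse is given by
  -- construction, so commutativity turns it into a left one.
  ⋆-solve : p 0 ≈ᴿ 1ᴿ → ∀ {f g} → (∀ n → (p ⋆ f) n ≈ᴿ g n) →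
    ∀ n → f n ≈ᴿ (S.inverse p ⋆ g) n
  ⋆-solve {p} p₀≈1 {f} {g} pf≈g n = begin
    f n                          ≈⟨ ⋆-identityˡ f n ⟨
    (S.one ⋆ f) n                ≈⟨ ⋆-cong p⁻¹p≈1 {f} (λ _ → reflᴿ) n ⟨
    ((S.inverse p ⋆ p) ⋆ f) n    ≈⟨ ⋆-assoc (S.inverse p) p f n ⟩
    (S.inverse p ⋆ (p ⋆ f)) n    ≈⟨ ⋆-cong {S.inverse p} (λ _ → reflᴿ) pf≈g n ⟩
    (S.inverse p ⋆ g) n          ∎
    where
    p⁻¹p≈1 : ∀ m → (S.inverse p ⋆ p) m ≈ᴿ S.one m
    p⁻¹p≈1 m = transᴿ (⋆-comm (S.inverse p) p m) (S.inverse-inverseʳ p p₀≈1 m)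

-- Ring solver for the reals with rational coefficients.

open CauchyProduct ℝ-commutativeRing
open CommutativeRing ℝ-commutativeRing
  using (setoid; *-congˡ; *-congʳ; +-congˡ; +-congʳ; +-cong; *-comm; *-identityʳ)
  renaming (refl to ≈-refl; trans to ≈-trans)

-- Rational coefficients have decidable equality, which real ones lack. Both sides of each
-- homomorphism law have the same constant sequence of terms, so the Cauchy property of that
-- sequence is the proof.
ℚ⟶ℝ : ℚ.+-*-rawRing -Raw-AlmostCommutative⟶ fromCommutativeRing ℝ-commutativeRing
ℚ⟶ℝ = record
  { ⟦_⟧    = fromℚ
  ; +-homo = λ p q → mk≈ (cauchy (fromℚ (p ℚ.+ q)))
  ; *-homo = λ p q → mk≈ (cauchy (fromℚ (p ℚ.* q)))
  ; -‿homo = λ p → mk≈ (cauchy (fromℚ (ℚ.- p)))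
  ; 0-homo = ≈-refl
  ; 1-homo = ≈-refl
  }

fromℚ-≟ : ∀ p q → Maybe (fromℚ p ≈ fromℚ q)
fromℚ-≟ p q with p ℚ.≟ q
... | yes refl = just ≈-refl
... | no  _    = nothing

open RingSolver ℚ.+-*-rawRing (fromCommutativeRing ℝ-commutativeRing) ℚ⟶ℝ fromℚ-≟
  using (solve; _:=_; _:+_; _:*_; _:-_; :-_; con; Polynomial)

private
  :0 :1 :2 :4 : ∀ {n} → Polynomial n
  :0 = con 0ℚ
  :1 = con 1ℚ
  -- Sums, as in `2#` and `4#`, so that solver polynomials evaluate definitionally to the goals.
  :2 = :1 :+ :1
  :4 = :2 :+ :2

-- The recurrence of step four and the product with the denominator.

module _ (a b : ℝ) where

  private
    D : Series ℝ
    D = polynomial 0# (1# ∷ 0# ∷ - (a * b + 4#) ∷ 0# ∷ 4# ∷ [])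

  -- Of two consecutive indices one is even and one is odd. Parity reduces by two definitionally, so
  -- two base cases suffice.
  consecutive-multipliers : ∀ n → multiplier a b (suc n) * multiplier a b n ≈ a * b
  consecutive-multipliers zero          = *-comm b a
  consecutive-multipliers (suc zero)    = ≈-refl
  consecutive-multipliers (suc (suc n)) = consecutive-multipliers n

  module _ {{_ : NonZero a}} where

    private
      J : Series (Matrix₂ ℝ)
      J = jacobsthal a b

    jacobsthal-step₄ : ∀ n i j → J (suc (suc (suc (suc n)))) i j
      ≈ (a * b + 4#) * J (suc (suc n)) i j - 4# * J n i j
    jacobsthal-step₄ n i j = begin
      -- The multipliers at `n`, `n + 2` and `n + 4` are all `m`. With `z` for the entry
      -- `m * y + 2# * x` at `n + 2`, the stray term `2# * (m * y)` equals `2# * z - 4# * x`, which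
      -- eliminates `y`.
      m * (m′ * (m * y + 2# * x) + 2# * y) + 2# * (m * y + 2# * x)
        ≈⟨ solve 4 (λ m m′ x y →
             m :* (m′ :* (m :* y :+ :2 :* x) :+ :2 :* y) :+ :2 :* (m :* y :+ :2 :* x)
             := (m′ :* m :+ :4) :* (m :* y :+ :2 :* x) :- :4 :* x) ≈-refl m m′ x y ⟩
      (m′ * m + 4#) * (m * y + 2# * x) - 4# * x
        ≈⟨ +-congʳ { - (4# * x) } (*-congʳ {m * y + 2# * x} (+-congʳ {4#} (consecutive-multipliers n))) ⟩
      (a * b + 4#) * (m * y + 2# * x) - 4# * x ∎
      where
      open ≈-Reasoning setoid
      m  = multiplier a b n
      m′ = multiplier a b (suc n)
      x  = J n i j
      y  = J (suc n) i j

    jacobsthal-numerator : Series (Matrix₂ ℝ)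
    jacobsthal-numerator = polynomial 0ᴹ
      ( J 0
      ∷ J 1
      ∷ (a ·ᴹ J 1 -ᴹ (a * b + 2#) ·ᴹ J 0)
      ∷ ((2# * b) ·ᴹ J 0 -ᴹ 2# ·ᴹ J 1)
      ∷ [])

    denominator-⊛ᴹ-jacobsthal : D ⊛ᴹ J ≈ᴹ jacobsthal-numerator
    denominator-⊛ᴹ-jacobsthal zero i j =
      solve 1 (λ x → :1 :* x :+ :0 := x) ≈-refl (J 0 i j)
    denominator-⊛ᴹ-jacobsthal (suc zero) i j =
      solve 2 (λ x y → :1 :* y :+ (:0 :* x :+ :0) := y) ≈-refl (J 0 i j) (J 1 i j)
    denominator-⊛ᴹ-jacobsthal (suc (suc zero)) i j =
      solve 4 (λ a b x y →
          :1 :* (a :* y :+ :2 :* x) :+ (:0 :* y :+ ((:- (a :* b :+ :4)) :* x :+ :0))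
          := a :* y :- (a :* b :+ :2) :* x)
        ≈-refl a b (J 0 i j) (J 1 i j)
    denominator-⊛ᴹ-jacobsthal (suc (suc (suc zero))) i j =
      solve 4 (λ a b x y →
          :1 :* (b :* (a :* y :+ :2 :* x) :+ :2 :* y) :+ (:0 :* (a :* y :+ :2 :* x)
            :+ ((:- (a :* b :+ :4)) :* y :+ (:0 :* x :+ :0)))
          := (:2 :* b) :* x :- :2 :* y)
        ≈-refl a b (J 0 i j) (J 1 i j)
    denominator-⊛ᴹ-jacobsthal (suc (suc (suc (suc n)))) i j = begin
      -- Four unfoldings of the product consume all of `D` but its leading coefficient, for every
      -- `n`.
      1# * J₄ + (0# * J₃ + (- s * J₂ + (0# * J₁ + (polynomial 0# (4# ∷ []) ⊛ (λ m → J m i j)) n)))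
        ≈⟨ +-cong (*-congˡ {1#} (jacobsthal-step₄ n i j))
             (+-congˡ {0# * J₃} (+-congˡ { - s * J₂ } (+-congˡ {0# * J₁} (constant-⋆ 4# (λ m → J m i j) n)))) ⟩
      1# * (s * J₂ - 4# * J₀) + (0# * J₃ + (- s * J₂ + (0# * J₁ + 4# * J₀)))
        ≈⟨ solve 5 (λ s x₀ x₁ x₂ x₃ →
             :1 :* (s :* x₂ :- :4 :* x₀) :+ (:0 :* x₃ :+ ((:- s) :* x₂ :+ (:0 :* x₁ :+ :4 :* x₀)))
             := :0) ≈-refl s J₀ J₁ J₂ J₃ ⟩
      0# ∎
      where
      open ≈-Reasoning setoid
      s = a * b + 4#
      J₀ J₁ J₂ J₃ J₄ : ℝ
      J₀ = J n i j
      J₁ = J (suc n) i j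
      J₂ = J (suc (suc n)) i j
      J₃ = J (suc (suc (suc n))) i j
      J₄ = J (suc (suc (suc (suc n)))) i j

    -- Component form of the numerator.

    component-numerator : Matrix₂ (Series ℝ)
    component-numerator =
      ( polynomial 0# (1# ∷ b ∷ - 2# ∷ [])
      V.∷ polynomial 0# (0# ∷ 2# * (b ÷ a) ∷ 2# * b ∷ - (4# * (b ÷ a)) ∷ [])
      V.∷ V.[])
      V.∷
      ( polynomial 0# (0# ∷ 1# ∷ a ∷ - 2# ∷ [])
      V.∷ polynomial 0# (1# ∷ 0# ∷ - (a * b + 2#) ∷ 2# * b ∷ [])
      V.∷ V.[])
      V.∷ V.[]

    -- Needed for the `x²` coefficient of the upper right entry, where `a` meets `2# * (b ÷ a)`; the
    -- other coefficients treat `b ÷ a` as an atom.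
    a*[b÷a]≈b : a * (b ÷ a) ≈ b
    a*[b÷a]≈b = begin
      a * (b * a ⁻¹)  ≈⟨ solve 3 (λ a b c → a :* (b :* c) := b :* (a :* c)) ≈-refl a b (a ⁻¹) ⟩
      b * (a * a ⁻¹)  ≈⟨ *-congˡ {b} (⁻¹-inverseʳ a) ⟩
      b * 1#          ≈⟨ *-identityʳ b ⟩
      b               ∎
      where open ≈-Reasoning setoid

    jacobsthal-numerator-components : jacobsthal-numerator ≈ᴹ collect component-numerator
    jacobsthal-numerator-components 0 zero       zero       = ≈-refl
    jacobsthal-numerator-components 0 zero       (suc zero) = ≈-refl
    jacobsthal-numerator-components 0 (suc zero) zero       = ≈-refl
    jacobsthal-numerator-components 0 (suc zero) (suc zero) = ≈-refl
    jacobsthal-numerator-components 1 zero       zero       = ≈-refl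
    jacobsthal-numerator-components 1 zero       (suc zero) = ≈-refl
    jacobsthal-numerator-components 1 (suc zero) zero       = ≈-refl
    jacobsthal-numerator-components 1 (suc zero) (suc zero) = ≈-refl
    jacobsthal-numerator-components 2 zero       zero       =
      solve 2 (λ a b → a :* b :- (a :* b :+ :2) :* :1 := :- :2) ≈-refl a b
    jacobsthal-numerator-components 2 zero       (suc zero) = begin
      a * (2# * (b ÷ a)) - (a * b + 2#) * 0#
        ≈⟨ solve 3 (λ a b c → a :* (:2 :* c) :- (a :* b :+ :2) :* :0 := :2 :* (a :* c))
             ≈-refl a b (b ÷ a) ⟩
      2# * (a * (b ÷ a))
        ≈⟨ *-congˡ {2#} a*[b÷a]≈b ⟩
      2# * b ∎
      where open ≈-Reasoning setoid
    jacobsthal-numerator-components 2 (suc zero) zero       =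
      solve 2 (λ a b → a :* :1 :- (a :* b :+ :2) :* :0 := a) ≈-refl a b
    jacobsthal-numerator-components 2 (suc zero) (suc zero) =
      solve 2 (λ a b → a :* :0 :- (a :* b :+ :2) :* :1 := :- (a :* b :+ :2)) ≈-refl a b
    -- The upper left polynomial has degree two, so its coefficient here is the default `0#`.
    jacobsthal-numerator-components 3 zero       zero       =
      solve 1 (λ b → (:2 :* b) :* :1 :- :2 :* b := :0) ≈-refl b
    jacobsthal-numerator-components 3 zero       (suc zero) =
      solve 2 (λ b c → (:2 :* b) :* :0 :- :2 :* (:2 :* c) := :- (:4 :* c)) ≈-refl b (b ÷ a)
    jacobsthal-numerator-components 3 (suc zero) zero       =
      solve 1 (λ b → (:2 :* b) :* :0 :- :2 :* :1 := :- :2) ≈-refl b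
    jacobsthal-numerator-components 3 (suc zero) (suc zero) =
      solve 1 (λ b → (:2 :* b) :* :1 :- :2 :* :0 := :2 :* b) ≈-refl b
    -- Past degree three both sides are the default zero; splitting on the indices lets the matrix
    -- entry reduce.
    jacobsthal-numerator-components (suc (suc (suc (suc n)))) zero       zero       = ≈-refl
    jacobsthal-numerator-components (suc (suc (suc (suc n)))) zero       (suc zero) = ≈-refl
    jacobsthal-numerator-components (suc (suc (suc (suc n)))) (suc zero) zero       = ≈-refl
    jacobsthal-numerator-components (suc (suc (suc (suc n)))) (suc zero) (suc zero) = ≈-refl

    -- The product acts on each entry separately, so the scalar `⋆-solve` applies entrywise. Leaving
    -- `N` free covers the matrix form and the component form at once.
    jacobsthal-≈ᴹ-/ : ∀ {N} → jacobsthal-numerator ≈ᴹ N → J ≈ᴹ N / D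
    jacobsthal-≈ᴹ-/ {N} N≈ n i j = ⋆-solve {D} ≈-refl {λ m → J m i j} {λ m → N m i j}
      (λ m → ≈-trans (denominator-⊛ᴹ-jacobsthal m i j) (N≈ m i j)) n

theorem7 : (a b : ℝ) {{_ : NonZero a}} {{_ : NonZero b}} →
  let J = jacobsthal a b
      D = polynomial 0# (1# ∷ 0# ∷ - (a * b + 4#) ∷ 0# ∷ 4# ∷ [])
  in
  (J ≈ᴹ polynomial 0ᴹ
          ( J 0
          ∷ J 1
          ∷ (a ·ᴹ J 1 -ᴹ (a * b + 2#) ·ᴹ J 0)
          ∷ ((2# * b) ·ᴹ J 0 -ᴹ 2# ·ᴹ J 1)
          ∷ []) / D)
  ×
  (J ≈ᴹ collect
          ( ( polynomial 0# (1# ∷ b ∷ - 2# ∷ [])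
            V.∷ polynomial 0# (0# ∷ 2# * (b ÷ a) ∷ 2# * b ∷ - (4# * (b ÷ a)) ∷ [])
            V.∷ V.[])
          V.∷
            ( polynomial 0# (0# ∷ 1# ∷ a ∷ - 2# ∷ [])
            V.∷ polynomial 0# (1# ∷ 0# ∷ - (a * b + 2#) ∷ 2# * b ∷ [])
            V.∷ V.[])
          V.∷ V.[]) / D)
theorem7 a b =
  jacobsthal-≈ᴹ-/ a b (λ _ _ _ → ≈-refl) ,
  jacobsthal-≈ᴹ-/ a b (jacobsthal-numerator-components a b)
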